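{- Let $\mathcal{R}$ be an oriented CTRS and let $s \approx t$ be an unconditional critical pair of $\mathcal{R}$. If $s$ and $t$ are not joinable with respect to the underlying TRS $\mathcal{R}_{\mathsf{u}}$ (that is, there is no term $w$ with $s \to_{\mathcal{R}_{\mathsf{u}}}^{*} w$ and $t \to_{\mathcal{R}_{\mathsf{u}}}^{*} w$), then $\mathcal{R}$ is non-confluent.
   Context: Terms are the first-order terms $\mathcal{T}(\mathcal{F},\mathcal{V})$ over a signature $\mathcal{F}$ and a countably infinite set of variables $\mathcal{V}$. A conditional term rewrite system (CTRS) $\mathcal{R}$ is a set of conditional rewrite rules $\ell \to r \Leftarrow c$ where $\ell, r$ are terms, $\ell \notin \mathcal{V}$, and $c$ is a (possibly empty) sequence of pairs of terms $s_1 \approx t_1, \ldots, s_k \approx t_k$. Right-hand sides may contain variables that do not occur in the left-hand side or in the conditions. All CTRSs are oriented: conditions are interpreted as reachability. For each level $i$ an (unconditional) TRS $\mathcal{R}_i$ is defined by $\mathcal{R}_0 = \varnothing$ and $\mathcal{R}_{i+1} = \{\ell\sigma \to r\sigma \mid (\ell \to r \Leftarrow c) \in \mathcal{R},\ \sigma \text{ a substitution},\ s\sigma \to_{\mathcal{R}_i}^{*} t\sigma \text{ for all } s \approx t \text{ in } c\}$. The rewrite relation of $\mathcal{R}$ is $\to_{\mathcal{R}} = \bigcup_{i \geq 0} \to_{\mathcal{R}_i}$, where the rewrite relation of a TRS is as usual (closed under contexts and substitutions). The underlying TRS $\mathcal{R}_{\mathsf{u}}$ is obtained from $\mathcal{R}$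 by dropping all conditions: $\mathcal{R}_{\mathsf{u}} = \{\ell \to r \mid (\ell \to r \Leftarrow c) \in \mathcal{R}\}$. Two variable-disjoint variants $\ell_1 \to r_1 \Leftarrow c_1$ and $\ell_2 \to r_2 \Leftarrow c_2$ of rules in $\mathcal{R}$ (a variant being the image of a rule under a bijective variable renaming), together with a position $p$ of $\ell_1$ such that $\ell_1|_p \notin \mathcal{V}$ and $\ell_1|_p\mu = \ell_2\mu$ with most general unifier $\mu$, constitute a conditional overlap. A conditional overlap that does not result from overlapping two variants of the same rule at the root position gives rise to the conditional critical pair $\ell_1[r_2]_p\mu \approx r_1\mu \Leftarrow c_1\mu, c_2\mu$. It is an unconditional critical pair, written $s \approx t$ with $s = \ell_1[r_2]_p\mu$ and $t = r_1\mu$, if both $c_1$ and $c_2$ are empty. $\mathcal{R}$ is confluent if whenever $s \to_{\mathcal{R}}^{*} t$ and $s \to_{\mathcal{R}}^{*} u$ there is a term $w$ with $t \to_{\mathcal{R}}^{*} w$ and $u \to_{\mathcal{R}}^{*} w$; it is non-confluent if it is not confluent. -}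

module Defs where

open import Data.Empty.Polymorphic using (⊥)
open import Data.Fin using (Fin)
open import Data.List using (List; []; map)
open import Data.List.Relation.Unary.All using (All)
import Data.List.Relation.Unary.Any as List
open import Data.Nat using (ℕ)
open import Data.Product using (Σ; ∃-syntax; _×_; _,_)
open import Data.Sum using (_⊎_)
open import Data.Vec using (Vec; []; _∷_; lookup; _[_]≔_)
import Data.Vec.Relation.Unary.Any as Vec
open import Function using (_↔_; Inverse)
open import Level using (Level; _⊔_) renaming (suc to lsuc)
open import Relation.Binary using (Rel)
open import Relation.Binary.Construct.Closure.ReflexiveTransitive using (Star)
open import Relation.Binary.PropositionalEquality using (_≡_)
open import Relation.Nullary using (¬_)

record Signature (o : Level) : Set (lsuc o) where
  field
    Symbol : Set o
    arity  : Symbol → ℕ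

open Signature public

-- The countably infinite set of variables is ℕ.
data Term {o} (F : Signature o) : Set o where
  var : ℕ → Term F
  fun : (f : Symbol F) → Vec (Term F) (arity F f) → Term F

module _ {o} {F : Signature o} where

  infix 4 _∈ᵛ_

  data IsVar : Term F → Set o where
    isVar : ∀ {x} → IsVar (var x)

  data _∈ᵛ_ (x : ℕ) : Term F → Set o where
    here  : x ∈ᵛ var x
    there : ∀ {f ts} → Vec.Any (x ∈ᵛ_) ts → x ∈ᵛ fun f ts

Subst : ∀ {o} → Signature o → Set o
Subst F = ℕ → Term F

module _ {o} {F : Signature o} where

  infixl 8 _[_] _[_]* _∣_

  mutual
    _[_] : Term F → Subst F → Term F
    var x    [ σ ] = σ x
    fun f ts [ σ ] = fun f (ts [ σ ]*)

    _[_]* : ∀ {n} → Vec (Term F) n → Subst F → Vec (Term F) n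
    []       [ σ ]* = []
    (t ∷ ts) [ σ ]* = t [ σ ] ∷ ts [ σ ]*

  data Pos : Term F → Set o where
    root : ∀ {t} → Pos t
    _▸_  : ∀ {f ts} (i : Fin (arity F f)) → Pos (lookup ts i) → Pos (fun f ts)

  infixr 5 _▸_

  _∣_ : (t : Term F) → Pos t → Term F
  t        ∣ root    = t
  fun f ts ∣ (i ▸ p) = lookup ts i ∣ p

  replaceAt : (t : Term F) → Pos t → Term F → Term F
  replaceAt t          root    u = u
  replaceAt (fun f ts) (i ▸ p) u = fun f (ts [ i ]≔ replaceAt (lookup ts i) p u)

  Unifies : Subst F → Term F → Term F → Set o
  Unifies μ s t = s [ μ ] ≡ t [ μ ]

  -- The factorisation τ = μδ is required at every variable, not only at those
  -- occurring in s and t.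
  IsMGU : Subst F → Term F → Term F → Set o
  IsMGU μ s t =
    Unifies μ s t ×
    (∀ τ → Unifies τ s t → ∃[ δ ] (∀ x → τ x ≡ μ x [ δ ]))

-- A TRS is a set of pairs l → r.
TRS : ∀ {o} → Signature o → (ℓ : Level) → Set (o ⊔ lsuc ℓ)
TRS F ℓ = Rel (Term F) ℓ

record Step {o ℓ} {F : Signature o} (T : TRS F ℓ) (s t : Term F) : Set (o ⊔ ℓ) where
  field
    {l r}  : Term F
    rule   : T l r
    σ      : Subst F
    pos    : Pos s
    redex  : s ∣ pos ≡ l [ σ ]
    result : t ≡ replaceAt s pos (r [ σ ])

Joinable : ∀ {a ℓ} {A : Set a} → Rel A ℓ → A → A → Set (a ⊔ ℓ)
Joinable _⟶_ s t = ∃[ w ] (Star _⟶_ s w × Star _⟶_ t w)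

infix 4 _⟶_⇐_

record Rule {o} (F : Signature o) : Set o where
  constructor _⟶_⇐_
  field
    lhs   : Term F
    rhs   : Term F
    conds : List (Term F × Term F)

open Rule public

record CTRS {o} (F : Signature o) (ℓ : Level) : Set (o ⊔ lsuc ℓ) where
  field
    IsRule     : Rule F → Set ℓ
    lhs-nonvar : ∀ {ρ} → IsRule ρ → ¬ IsVar (lhs ρ)

open CTRS public

module _ {o ℓ} {F : Signature o} (R : CTRS F ℓ) where

  -- level i is the TRS Rᵢ; conditions are interpreted as reachability.
  level : ℕ → TRS F (o ⊔ ℓ)
  level ℕ.zero    _ _ = ⊥
  level (ℕ.suc i) u v =
    ∃[ ρ ] ∃[ σ ] ( IsRule R ρ
                  × All (λ (s , t) → Star (Step (level i)) (s [ σ ]) (t [ σ ])) (conds ρ)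
                  × u ≡ lhs ρ [ σ ]
                  × v ≡ rhs ρ [ σ ])

  Rewrites : Rel (Term F) (o ⊔ ℓ)
  Rewrites s t = ∃[ i ] Step (level i) s t

  underlying : TRS F (o ⊔ ℓ)
  underlying l r = ∃[ c ] IsRule R (l ⟶ r ⇐ c)

module _ {o} {F : Signature o} where

  infix 4 _VariantOf_ _∈Rule_

  renameRule : (ℕ → ℕ) → Rule F → Rule F
  renameRule π (l ⟶ r ⇐ c) = l [ ϖ ] ⟶ r [ ϖ ] ⇐ map (λ (s , t) → s [ ϖ ] , t [ ϖ ]) c
    where
    ϖ : Subst F
    ϖ x = var (π x)

  _VariantOf_ : Rule F → Rule F → Set o
  ρ′ VariantOf ρ = Σ (ℕ ↔ ℕ) λ π → ρ′ ≡ renameRule (Inverse.to π) ρ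

  _∈Rule_ : ℕ → Rule F → Set o
  x ∈Rule ρ =
    x ∈ᵛ lhs ρ ⊎ x ∈ᵛ rhs ρ ⊎ List.Any (λ (s , t) → x ∈ᵛ s ⊎ x ∈ᵛ t) (conds ρ)

  VariableDisjoint : Rule F → Rule F → Set o
  VariableDisjoint ρ₁ ρ₂ = ∀ x → x ∈Rule ρ₁ → ¬ x ∈Rule ρ₂

module _ {o ℓ} {F : Signature o} (R : CTRS F ℓ) where

  VariantOfRule : Rule F → Set (o ⊔ ℓ)
  VariantOfRule ρ′ = ∃[ ρ ] (IsRule R ρ × ρ′ VariantOf ρ)

  record ConditionalOverlap : Set (o ⊔ ℓ) where
    field
      ρ₁ ρ₂    : Rule F
      variant₁ : VariantOfRule ρ₁
      variant₂ : VariantOfRule ρ₂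
      disjoint : VariableDisjoint ρ₁ ρ₂
      p        : Pos (lhs ρ₁)
      nonvar   : ¬ IsVar (lhs ρ₁ ∣ p)
      μ        : Subst F
      mgu      : IsMGU μ (lhs ρ₁ ∣ p) (lhs ρ₂)

  module _ (O : ConditionalOverlap) where
    open ConditionalOverlap O

    SameRuleAtRoot : Set (o ⊔ ℓ)
    SameRuleAtRoot =
      p ≡ root × ∃[ ρ ] (IsRule R ρ × ρ₁ VariantOf ρ × ρ₂ VariantOf ρ)

    -- The critical pair s ≈ t ⇐ c₁μ, c₂μ with c₁ and c₂ both empty.
    GivesUnconditional : Term F → Term F → Set (o ⊔ ℓ)
    GivesUnconditional s t =
      ¬ SameRuleAtRoot ×
      conds ρ₁ ≡ [] × conds ρ₂ ≡ [] ×
      s ≡ replaceAt (lhs ρ₁) p (rhs ρ₂) [ μ ] ×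
      t ≡ rhs ρ₁ [ μ ]

  UnconditionalCriticalPair : Term F → Term F → Set (o ⊔ ℓ)
  UnconditionalCriticalPair s t = ∃[ O ] GivesUnconditional O s t

{-# OPTIONS --safe #-}

-- The two terms of an unconditional critical pair are one-step reducts of the
-- instance ℓ₁μ, both at level 1 because neither rule has conditions to check.
-- Confluence of R would therefore join them, and every R-step is a step of the
-- underlying TRS.
module Submission where

open import Data.Fin using (zero; suc)
open import Data.List using ([])
open import Data.List.Relation.Unary.All using ([])
open import Data.Product using (_,_)
open import Data.Nat using (suc)
open import Data.Vec using (Vec; []; _∷_; lookup; _[_]≔_)
open import Function using (Inverse)
open import Level using (Level)
open import Relation.Binary.Construct.Closure.ReflexiveTransitive using (map; return)
open import Relation.Binary.PropositionalEquality
  using (_≡_; refl; sym; trans; cong; cong₂; subst)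
open import Relation.Binary.Rewriting using (Confluent)
open import Relation.Nullary using (¬_)
open import Defs

module _ {o} {F : Signature o} where

  infixl 8 _⊙_

  _⊙_ : Subst F → Subst F → Subst F
  (σ ⊙ τ) x = σ x [ τ ]

  mutual
    []-⊙ : ∀ t (σ τ : Subst F) → t [ σ ] [ τ ] ≡ t [ σ ⊙ τ ]
    []-⊙ (var x)    σ τ = refl
    []-⊙ (fun f ts) σ τ = cong (fun f) ([]*-⊙ ts σ τ)

    []*-⊙ : ∀ {n} (ts : Vec (Term F) n) (σ τ : Subst F) →
            ts [ σ ]* [ τ ]* ≡ ts [ σ ⊙ τ ]*
    []*-⊙ []       σ τ = refl
    []*-⊙ (t ∷ ts) σ τ = cong₂ _∷_ ([]-⊙ t σ τ) ([]*-⊙ ts σ τ)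

  lookup-[]* : ∀ {n} (ts : Vec (Term F) n) i (σ : Subst F) →
               lookup (ts [ σ ]*) i ≡ lookup ts i [ σ ]
  lookup-[]* (t ∷ ts) zero    σ = refl
  lookup-[]* (t ∷ ts) (suc i) σ = lookup-[]* ts i σ

  []≔-[]* : ∀ {n} (ts : Vec (Term F) n) i u (σ : Subst F) →
            (ts [ i ]≔ u) [ σ ]* ≡ ts [ σ ]* [ i ]≔ u [ σ ]
  []≔-[]* (t ∷ ts) zero    u σ = refl
  []≔-[]* (t ∷ ts) (suc i) u σ = cong (t [ σ ] ∷_) ([]≔-[]* ts i u σ)

  module _ {ℓ} {T : TRS F ℓ} where

    step-root : ∀ {l r} → T l r → (σ : Subst F) → Step T (l [ σ ]) (r [ σ ])
    step-root lr σ = record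
      { rule = lr ; σ = σ ; pos = root ; redex = refl ; result = refl }

    step-arg : ∀ f {ts : Vec (Term F) (arity F f)} i {s t} → lookup ts i ≡ s →
               Step T s t → Step T (fun f ts) (fun f (ts [ i ]≔ t))
    step-arg f {ts} i refl st = record
      { rule   = rule
      ; σ      = σ
      ; pos    = i ▸ pos
      ; redex  = redex
      ; result = cong (λ u → fun f (ts [ i ]≔ u)) result
      }
      where open Step st

    -- `p` is typed by `t` and is not literally a position of `t [ σ ]`. Induction on `p` rebuilds
    -- the context one symbol at a time instead of translating `p`.
    step-replaceAt : ∀ t (p : Pos t) {u} (σ : Subst F) →
                     Step T ((t ∣ p) [ σ ]) (u [ σ ]) →
                     Step T (t [ σ ]) (replaceAt t p u [ σ ])
    step-replaceAt t          root    σ st = st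
    step-replaceAt (fun f ts) (i ▸ p) σ st =
      subst (λ us → Step T (fun f (ts [ σ ]*)) (fun f us))
            (sym ([]≔-[]* ts i _ σ))
            (step-arg f i (lookup-[]* ts i σ) (step-replaceAt (lookup ts i) p σ st))

module _ {o ℓ} {F : Signature o} (R : CTRS F ℓ) where

  -- A renaming is a substitution, and levels contain all instances of rules. Renaming preserves the
  -- number of conditions, so the original rule has none either.
  unconditional⇒level-1 : ∀ {ρ} → VariantOfRule R ρ → conds ρ ≡ [] →
                          level R 1 (lhs ρ) (rhs ρ)
  unconditional⇒level-1 ((l ⟶ r ⇐ []) , ρ∈R , π , refl) refl =
    _ , (λ x → var (Inverse.to π x)) , ρ∈R , [] , refl , refl

  rewrites⇒underlying : ∀ {s t} → Rewrites R s t → Step (underlying R) s t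
  rewrites⇒underlying {s} (suc i , record
    { rule = ρ , σ , ρ∈R , _ , refl , refl ; σ = τ ; pos = p
    ; redex = redex ; result = result }) = record
    { rule   = conds ρ , ρ∈R
    -- The level already holds the instance of `ρ` under `σ`, and the step instantiates it again by
    -- `τ`.
    ; σ      = σ ⊙ τ
    ; pos    = p
    ; redex  = trans redex ([]-⊙ (lhs ρ) σ τ)
    ; result = trans result (cong (replaceAt s p) ([]-⊙ (rhs ρ) σ τ))
    }

lemma3 : ∀ {o ℓ : Level} {F : Signature o} (R : CTRS F ℓ) {s t : Term F} →
    UnconditionalCriticalPair R s t →
    ¬ Joinable (Step (underlying R)) s t →
    ¬ Confluent (Rewrites R)
lemma3 R (O , _ , c₁≡[] , c₂≡[] , refl , refl) ¬joinable confluent =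
  let w , s↠w , t↠w = confluent (return (1 , ℓ₁μ⟶s)) (return (1 , ℓ₁μ⟶t))
  in ¬joinable (w , map (rewrites⇒underlying R) s↠w , map (rewrites⇒underlying R) t↠w)
  where
  open ConditionalOverlap O

  ℓ₁μ⟶t : Step (level R 1) (lhs ρ₁ [ μ ]) (rhs ρ₁ [ μ ])
  ℓ₁μ⟶t = step-root (unconditional⇒level-1 R variant₁ c₁≡[]) μ

  ℓ₁μ⟶s : Step (level R 1) (lhs ρ₁ [ μ ]) (replaceAt (lhs ρ₁) p (rhs ρ₂) [ μ ])
  ℓ₁μ⟶s with unifies , _ ← mgu =
    -- The contracted redex is `lhs ρ₂ [ μ ]`, which `unifies` identifies with the instance of the
    -- subterm of `lhs ρ₁` at `p`.
    step-replaceAt (lhs ρ₁) p μ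
      (subst (λ u → Step (level R 1) u (rhs ρ₂ [ μ ])) (sym unifies)
             (step-root (unconditional⇒level-1 R variant₂ c₂≡[]) μ))
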